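{- There exists an absolute constant $c>0$ such that for every sufficiently large prime power $q$ there is a collection $\mathcal{C}$ of point sets in $\mathbb{F}^2_q$ satisfying: (i) every general position set of $\mathbb{F}^2_q$ is contained in some member of $\mathcal{C}$; (ii) $|C|\le 9q$ for all $C\in \mathcal{C}$; and (iii) $|\mathcal{C}|\le 2^{c \cdot q^{1/2}(\log q)^2}$.
   Context: $\mathbb{F}_q$ is the finite field with $q$ elements. A point set in $\mathbb{F}_q^2$ is in general position if no three of its points lie on a common line. $\log$ is in base $2$. -}

module Defs where

open import Level using (0ℓ)
open import Data.Nat using (ℕ; _≤_; _^_)
open import Data.Nat.Primality using (Prime)
open import Data.Fin using (Fin)
open import Data.Fin.Properties using ()
open import Data.Bool using (Bool; true; false; T; if_then_else_)
open import Data.List using (List; map; allFin; cartesianProduct)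
open import Data.Nat.ListAction using (sum)
open import Data.Product using (_×_; _,_; Σ; ∃; ∃-syntax)
open import Relation.Binary.PropositionalEquality using (_≡_)
open import Relation.Nullary using (¬_)
open import Algebra.Structures using (IsCommutativeRing)

IsPrimePower : ℕ → Set
IsPrimePower q = ∃[ p ] ∃[ k ] (Prime p × 1 ≤ k × q ≡ p ^ k)

record FiniteField (q : ℕ) : Set where
  field
    _+_ _*_ : Fin q → Fin q → Fin q
    -_      : Fin q → Fin q
    0# 1#   : Fin q
    isCommutativeRing : IsCommutativeRing _≡_ _+_ _*_ -_ 0# 1#
    0≢1     : ¬ (0# ≡ 1#)
    inverse : ∀ x → ¬ (x ≡ 0#) → ∃[ y ] (x * y ≡ 1#)

module _ {q : ℕ} (F : FiniteField q) where
  open FiniteField F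

  Point : Set
  Point = Fin q × Fin q

  allPoints : List Point
  allPoints = cartesianProduct (allFin q) (allFin q)

  PointSet : Set
  PointSet = Point → Bool

  _∈ₛ_ : Point → PointSet → Set
  p ∈ₛ S = T (S p)

  card : PointSet → ℕ
  card S = sum (map (λ p → if S p then 1 else 0) allPoints)

  _⊆ₛ_ : PointSet → PointSet → Set
  S ⊆ₛ C = ∀ p → p ∈ₛ S → p ∈ₛ C

  OnLine : Fin q → Fin q → Fin q → Point → Set
  OnLine a b c (x , y) = (a * x) + (b * y) ≡ c

  Collinear : Point → Point → Point → Set
  Collinear p₁ p₂ p₃ =
    ∃[ a ] ∃[ b ] ∃[ c ] (¬ (a ≡ 0# × b ≡ 0#) × OnLine a b c p₁ × OnLine a b c p₂ × OnLine a b c p₃)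

  GeneralPosition : PointSet → Set
  GeneralPosition S = ∀ p₁ p₂ p₃ → p₁ ∈ₛ S → p₂ ∈ₛ S → p₃ ∈ₛ S →
    ¬ (p₁ ≡ p₂) → ¬ (p₁ ≡ p₃) → ¬ (p₂ ≡ p₃) → ¬ Collinear p₁ p₂ p₃

{-# OPTIONS --safe #-}

-- Let k be about √q and fix any k points V of a general position set S. For any set A of more than
-- 4(q + 1) points and any v, the q + 1 lines through v split A into classes, so by convexity some
-- x ∈ A has about k|A|/q points of A, counted with multiplicity, on the lines joining x to V. If
-- x ∉ S, delete x from A. If x ∈ S, these k lines are distinct and contain no further points of S,
-- so all their points can be deleted, and A shrinks by a factor 1 - Ω(1/√q). The latter happens
-- O(√q log q) times before |A| ≤ 4(q + 1). What is left of A, together with V and the chosen points,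
-- then contains S and has at most 4(q + 1) + (q + 2) points, since |S| ≤ q + 2; it depends only on V
-- and the chosen points, which are O(√q log q) points altogether.
module Submission where

open import Defs
open import Data.Nat using (ℕ; _≤_; _<_; _*_; _^_)
open import Data.List using (List; length)
open import Data.List.Relation.Unary.All using (All)
open import Data.List.Membership.Propositional using (_∈_)
open import Data.Product using (_×_; ∃-syntax)

open import Level using (0ℓ)
open import Algebra.Bundles using (CommutativeRing)
import Algebra.Properties.Ring as RingProperties
open import Data.Bool using (T; if_then_else_)
open import Data.Bool.Properties using (T?)
open import Data.Fin as Fin using (Fin; zero; suc)
open import Data.Nat using (zero; suc)
open import Data.Product using (_,_; proj₁; proj₂)
open import Data.Product.Properties using (≡-dec)
open import Relation.Binary using (DecidableEquality)
open import Relation.Binary.PropositionalEquality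
  using (_≡_; _≢_; refl; sym; trans; cong; cong₂; subst; module ≡-Reasoning)
open import Relation.Nullary using (Dec; yes; no; ¬_; ¬?; does; contradiction)

-- Lines, directions and general position in the affine plane.

module Plane {q : ℕ} (F : FiniteField q) where
  open FiniteField F using (0#; 1#; 0≢1; isCommutativeRing; inverse)

  infix 4 _≟_
  _≟_ : DecidableEquality (Point F)
  _≟_ = ≡-dec Fin._≟_ Fin._≟_

  commutativeRing : CommutativeRing 0ℓ 0ℓ
  commutativeRing = record { isCommutativeRing = isCommutativeRing }

  open CommutativeRing commutativeRing
    using (_+_; -_; _-_; ring; +-assoc; *-assoc; *-comm; *-identityˡ; *-identityʳ; zeroˡ; zeroʳ;
           distribˡ; +-identityʳ; +-identityˡ; -‿inverseˡ; -‿inverseʳ)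
    renaming (_*_ to _·_)
  open RingProperties ring using (x∙y⁻¹≈ε⇒x≈y; -‿distribˡ-*; -‿distribʳ-*; +-cancelˡ; +-cancelʳ)

  -- The lines with slope m ∈ 𝔽_q, resp. the vertical ones, are the level sets of
  -- level (suc m), resp. of level zero.
  level : Fin (suc q) → Point F → Fin q
  level zero    (x , y) = x
  level (suc m) (x , y) = - m · x + y

  -- The value slope p p = zero carries no meaning, but is consistent with level-slope.
  slope : Point F → Point F → Fin (suc q)
  slope (x₁ , y₁) (x₂ , y₂) with x₂ Fin.≟ x₁
  ... | yes _     = zero
  ... | no x₂≢x₁ = suc ((y₂ - y₁) · proj₁ (inverse (x₂ - x₁) λ eq → x₂≢x₁ (x∙y⁻¹≈ε⇒x≈y _ _ eq)))

  private
    shift : ∀ m x₁ x₂ y₁ → m · x₂ + (- m · x₁ + y₁) ≡ m · (x₂ - x₁) + y₁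
    shift m x₁ x₂ y₁ = begin
      m · x₂ + (- m · x₁ + y₁)   ≡⟨ +-assoc _ _ _ ⟨
      m · x₂ + - m · x₁ + y₁     ≡⟨ cong (λ z → m · x₂ + z + y₁) (-‿distribˡ-* m x₁) ⟨
      m · x₂ + - (m · x₁) + y₁   ≡⟨ cong (λ z → m · x₂ + z + y₁) (-‿distribʳ-* m x₁) ⟩
      m · x₂ + m · - x₁ + y₁     ≡⟨ cong (_+ y₁) (distribˡ m x₂ (- x₁)) ⟨
      m · (x₂ - x₁) + y₁         ∎
      where open ≡-Reasoning

    cancel-+ : ∀ x y → x - y + y ≡ x
    cancel-+ x y = trans (+-assoc x (- y) y) (trans (cong (x +_) (-‿inverseˡ y)) (+-identityʳ x))

    shift-self : ∀ m x y → m · x + (- m · x + y) ≡ y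
    shift-self m x y = trans (shift m x x y) (trans (cong (λ z → m · z + y) (-‿inverseʳ x))
      (trans (cong (_+ y) (zeroʳ m)) (+-identityˡ y)))

  -- Adding `m · x₂` to both levels leaves `m · (x₂ - x₁) + y₁` and `y₂`, so this and its converse
  -- `slope⇒level` are cancellations.
  level⇒slope : ∀ m {x₁ y₁ x₂ y₂} → - m · x₁ + y₁ ≡ - m · x₂ + y₂ → m · (x₂ - x₁) ≡ y₂ - y₁
  level⇒slope m {x₁} {y₁} {x₂} {y₂} eq = +-cancelʳ y₁ _ _ (begin
    m · (x₂ - x₁) + y₁         ≡⟨ shift m x₁ x₂ y₁ ⟨
    m · x₂ + (- m · x₁ + y₁)   ≡⟨ cong (m · x₂ +_) eq ⟩
    m · x₂ + (- m · x₂ + y₂)   ≡⟨ shift-self m x₂ y₂ ⟩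
    y₂                         ≡⟨ cancel-+ y₂ y₁ ⟨
    y₂ - y₁ + y₁               ∎)
    where open ≡-Reasoning

  slope⇒level : ∀ m {x₁ y₁ x₂ y₂} → m · (x₂ - x₁) ≡ y₂ - y₁ → - m · x₁ + y₁ ≡ - m · x₂ + y₂
  slope⇒level m {x₁} {y₁} {x₂} {y₂} eq = +-cancelˡ (m · x₂) _ _ (begin
    m · x₂ + (- m · x₁ + y₁)   ≡⟨ shift m x₁ x₂ y₁ ⟩
    m · (x₂ - x₁) + y₁         ≡⟨ cong (_+ y₁) eq ⟩
    y₂ - y₁ + y₁               ≡⟨ cancel-+ y₂ y₁ ⟩
    y₂                         ≡⟨ shift-self m x₂ y₂ ⟨
    m · x₂ + (- m · x₂ + y₂)   ∎)
    where open ≡-Reasoning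

  *-cancelʳ : ∀ {x y z} → z ≢ 0# → x · z ≡ y · z → x ≡ y
  *-cancelʳ {x} {y} {z} z≢0 xz≡yz with w , zw≡1 ← inverse z z≢0 = begin
    x             ≡⟨ *-identityʳ x ⟨
    x · 1#        ≡⟨ cong (x ·_) zw≡1 ⟨
    x · (z · w)   ≡⟨ *-assoc x z w ⟨
    x · z · w     ≡⟨ cong (_· w) xz≡yz ⟩
    y · z · w     ≡⟨ *-assoc y z w ⟩
    y · (z · w)   ≡⟨ cong (y ·_) zw≡1 ⟩
    y · 1#        ≡⟨ *-identityʳ y ⟩
    y             ∎
    where open ≡-Reasoning

  level-slope : ∀ p r → level (slope p r) p ≡ level (slope p r) r
  level-slope (x₁ , y₁) (x₂ , y₂) with x₂ Fin.≟ x₁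
  ... | yes x₂≡x₁ = sym x₂≡x₁
  ... | no x₂≢x₁
    with d⁻¹ , dd⁻¹≡1 ← inverse (x₂ - x₁) (λ eq → x₂≢x₁ (x∙y⁻¹≈ε⇒x≈y _ _ eq)) =
    slope⇒level ((y₂ - y₁) · d⁻¹) (begin
      (y₂ - y₁) · d⁻¹ · (x₂ - x₁)     ≡⟨ *-assoc _ d⁻¹ _ ⟩
      (y₂ - y₁) · (d⁻¹ · (x₂ - x₁))   ≡⟨ cong ((y₂ - y₁) ·_) (trans (*-comm d⁻¹ _) dd⁻¹≡1) ⟩
      (y₂ - y₁) · 1#                  ≡⟨ *-identityʳ _ ⟩
      y₂ - y₁                         ∎)
    where open ≡-Reasoning

  -- Two distinct points span one line. If their first coordinates agree, a non-vertical line
  -- through both would force `p ≡ r`; otherwise `m` and `m′` are the same quotient of differences.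
  level-unique : ∀ s s′ {p r} → p ≢ r → level s p ≡ level s r → level s′ p ≡ level s′ r → s ≡ s′
  level-unique zero    zero     p≢r _    _    = refl
  level-unique zero    (suc m)  p≢r refl eq   = contradiction (cong (_ ,_) (+-cancelˡ _ _ _ eq)) p≢r
  level-unique (suc m) zero     p≢r eq   refl = contradiction (cong (_ ,_) (+-cancelˡ _ _ _ eq)) p≢r
  level-unique (suc m) (suc m′) {x₁ , y₁} {x₂ , y₂} p≢r eq eq′ with x₂ Fin.≟ x₁
  ... | yes refl  = contradiction (cong (_ ,_) (+-cancelˡ _ _ _ eq)) p≢r
  ... | no x₂≢x₁ = cong suc (*-cancelʳ (λ d≡0 → x₂≢x₁ (x∙y⁻¹≈ε⇒x≈y _ _ d≡0))
                     (trans (level⇒slope m eq) (sym (level⇒slope m′ eq′))))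

  level-collinear : ∀ s {p₁ p₂ p₃} → level s p₂ ≡ level s p₁ → level s p₃ ≡ level s p₁ → Collinear F p₁ p₂ p₃
  level-collinear zero    {p₁} eq₂ eq₃ =
    1# , 0# , proj₁ p₁ , (λ (1≡0 , _) → 0≢1 (sym 1≡0)) , on refl , on eq₂ , on eq₃
    where
    on : ∀ {p} → proj₁ p ≡ proj₁ p₁ → OnLine F 1# 0# (proj₁ p₁) p
    on {x , y} eq = trans (cong₂ _+_ (*-identityˡ x) (zeroˡ y)) (trans (+-identityʳ x) eq)
  level-collinear (suc m) {p₁} eq₂ eq₃ =
    - m , 1# , level (suc m) p₁ , (λ (_ , 1≡0) → 0≢1 (sym 1≡0)) , on refl , on eq₂ , on eq₃
    where
    on : ∀ {p} → level (suc m) p ≡ level (suc m) p₁ → OnLine F (- m) 1# (level (suc m) p₁) p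
    on {x , y} eq = trans (cong (- m · x +_) (*-identityˡ y)) eq

  module InGeneralPosition {S : PointSet F} (gp : GeneralPosition F S) where

    -- Distinct `x` and `y` in the same direction from `v` would be collinear with `v`.
    slope-injective : ∀ {v x y} → T (S v) → T (S x) → T (S y) → v ≢ x → v ≢ y →
                      slope v x ≡ slope v y → x ≡ y
    slope-injective {v} {x} {y} v∈S x∈S y∈S v≢x v≢y eq with x ≟ y
    ... | yes x≡y = x≡y
    ... | no x≢y = contradiction
      (level-collinear (slope v x) (sym (level-slope v x))
        (subst (λ s → level s y ≡ level s v) (sym eq) (sym (level-slope v y))))
      (gp v x y v∈S x∈S y∈S v≢x v≢y x≢y)

    -- If v ≠ w, then the lines xv and xw are distinct, since x, v, w ∈ S, and so meet only in x.
    pencil-disjoint : ∀ {x y v w} → T (S x) → T (S v) → T (S w) → v ≢ x → w ≢ x → y ≢ x →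
                      slope v y ≡ slope v x → slope w y ≡ slope w x → v ≡ w
    pencil-disjoint {x} {y} {v} {w} x∈S v∈S w∈S v≢x w≢x y≢x eqv eqw with v ≟ w
    ... | yes v≡w = v≡w
    ... | no v≢w = contradiction
      (level-collinear (slope v x) (level-slope v x)
        (subst (λ s → level s w ≡ level s x) (sym same) (level-slope w x)))
      (gp x v w x∈S v∈S w∈S (λ { refl → v≢x refl }) (λ { refl → w≢x refl }) v≢w)
      where
      through : ∀ v → slope v y ≡ slope v x → level (slope v x) y ≡ level (slope v x) x
      through v eq = trans (subst (λ s → level s y ≡ level s v) eq (sym (level-slope v y))) (level-slope v x)
      -- Both lines contain the distinct points `x` and `y`, so they coincide, which puts `w` on the
      -- line joining `v` and `x`.
      same : slope v x ≡ slope w x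
      same = level-unique _ _ y≢x (through v eqv) (through w eqw)

open import Data.Nat
  using (_+_; _/_; z≤n; s≤s; s≤s⁻¹; _≤?_; NonZero; >-nonZero)
open import Data.Nat.DivMod using (m/n*n≤m; m≡m%n+[m/n]*n; m%n<n)
open import Data.Nat.ListAction using (sum)
open import Data.Nat.Properties hiding (_≟_)
open import Data.Nat.Tactic.RingSolver using (solve-∀)
open import Data.List
  using ([]; _∷_; _++_; [_]; map; filter; allFin; concatMap; cartesianProductWith; take)
open import Data.List.Properties
  using (length-++; length-map; length-filter; filter-notAll; length-take; length-tabulate)
open import Data.List.Membership.Propositional using (_∉_; find; lose)
open import Data.List.Membership.Propositional.Properties
open import Data.List.Relation.Unary.All as All using ([]; _∷_)
import Data.List.Relation.Unary.All.Properties as All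
open import Data.List.Relation.Unary.AllPairs using ([]; _∷_)
open import Data.List.Relation.Unary.Any using (Any; here; there; any?)
open import Data.List.Relation.Unary.Unique.Propositional using (Unique)
open import Data.List.Relation.Unary.Unique.Propositional.Properties
  using (filter⁺; take⁺; cartesianProduct⁺; allFin⁺)
open import Data.Maybe using (Maybe; just; nothing)
open import Data.Sum using (_⊎_; inj₁; inj₂; [_,_]′)
open import Data.Unit using (tt)
open import Function using (_∘_; id)
open import Relation.Nullary.Decidable using (dec-true)
open import Relation.Unary using (Pred; Decidable)

private variable
  X Y Z : Set

-- Finite sums, double counting and convexity.

∑ : List X → (X → ℕ) → ℕ
∑ xs f = sum (map f xs)

∑-mono : ∀ (xs : List X) {f g} → (∀ {x} → x ∈ xs → f x ≤ g x) → ∑ xs f ≤ ∑ xs g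
∑-mono []       f≤g = z≤n
∑-mono (x ∷ xs) f≤g = +-mono-≤ (f≤g (here refl)) (∑-mono xs λ x∈xs → f≤g (there x∈xs))

∑-+ : ∀ (xs : List X) f g → ∑ xs (λ x → f x + g x) ≡ ∑ xs f + ∑ xs g
∑-+ []       f g = refl
∑-+ (x ∷ xs) f g rewrite ∑-+ xs f g = interchange (f x) (g x) (∑ xs f) (∑ xs g)
  where
  interchange : ∀ a b c d → a + b + (c + d) ≡ a + c + (b + d)
  interchange = solve-∀

∑-*ˡ : ∀ (xs : List X) c f → ∑ xs (λ x → c * f x) ≡ c * ∑ xs f
∑-*ˡ []       c f = sym (*-zeroʳ c)
∑-*ˡ (x ∷ xs) c f rewrite ∑-*ˡ xs c f = sym (*-distribˡ-+ c (f x) _)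

∑-*ʳ : ∀ (xs : List X) f c → ∑ xs (λ x → f x * c) ≡ ∑ xs f * c
∑-*ʳ []       f c = refl
∑-*ʳ (x ∷ xs) f c rewrite ∑-*ʳ xs f c = sym (*-distribʳ-+ c (f x) _)

∑-const : ∀ (xs : List X) c → ∑ xs (λ _ → c) ≡ length xs * c
∑-const []       c = refl
∑-const (x ∷ xs) c = cong (c +_) (∑-const xs c)

∑-swap : ∀ (xs : List X) (ys : List Y) (f : X → Y → ℕ) →
         ∑ xs (λ x → ∑ ys (f x)) ≡ ∑ ys (λ y → ∑ xs (λ x → f x y))
∑-swap []       ys f = sym (trans (∑-const ys 0) (*-zeroʳ (length ys)))
∑-swap (x ∷ xs) ys f rewrite ∑-swap xs ys f = sym (∑-+ ys (f x) _)

∑-1 : ∀ (xs : List X) → ∑ xs (λ _ → 1) ≡ length xs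
∑-1 xs = trans (∑-const xs 1) (*-identityʳ _)

𝟙 : {P : Set} → Dec P → ℕ
𝟙 P? = if does P? then 1 else 0

module _ {P : Pred X 0ℓ} (P? : Decidable P) where

  length-filter-∑ : ∀ xs → length (filter P? xs) ≡ ∑ xs (λ x → 𝟙 (P? x))
  length-filter-∑ []       = refl
  length-filter-∑ (x ∷ xs) with P? x
  ... | yes _ = cong suc (length-filter-∑ xs)
  ... | no  _ = length-filter-∑ xs

  ∑𝟙≡0 : ∀ xs → (∀ {x} → x ∈ xs → ¬ P x) → ∑ xs (λ x → 𝟙 (P? x)) ≡ 0
  ∑𝟙≡0 []       ¬P = refl
  ∑𝟙≡0 (x ∷ xs) ¬P with P? x
  ... | yes p = contradiction p (¬P (here refl))
  ... | no  _ = ∑𝟙≡0 xs λ x∈xs → ¬P (there x∈xs)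

  ∑𝟙≤1 : ∀ {xs} → Unique xs → (∀ {x y} → x ∈ xs → y ∈ xs → P x → P y → x ≡ y) →
         ∑ xs (λ x → 𝟙 (P? x)) ≤ 1
  ∑𝟙≤1 []                 _    = z≤n
  ∑𝟙≤1 {x ∷ xs} (x∉ ∷ uniq) same with P? x
  ... | yes p = s≤s (≤-reflexive (∑𝟙≡0 xs λ y∈xs q →
                  All.lookup x∉ y∈xs (same (here refl) (there y∈xs) p q)))
  ... | no  _ = ∑𝟙≤1 uniq λ y∈ z∈ → same (there y∈) (there z∈)

  1≤∑𝟙 : ∀ {x xs} → x ∈ xs → P x → 1 ≤ ∑ xs (λ x → 𝟙 (P? x))
  1≤∑𝟙 {x} (here refl) p with P? x
  ... | yes _ = s≤s z≤n
  ... | no ¬p = contradiction p ¬p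
  1≤∑𝟙 (there x∈xs) p = ≤-trans (1≤∑𝟙 x∈xs p) (m≤n+m _ _)

𝟙≤1 : {P : Set} (P? : Dec P) → 𝟙 P? ≤ 1
𝟙≤1 (yes _) = s≤s z≤n
𝟙≤1 (no _)  = z≤n

-- Double counting of the pairs with `f x ≡ y`: each `x` is in at least one and, by injectivity,
-- each `y` in at most one.
injectiveOn⇒length≤ : DecidableEquality Y → ∀ {xs : List X} {ys : List Y} (f : X → Y) → Unique xs →
  (∀ {x y} → x ∈ xs → y ∈ xs → f x ≡ f y → x ≡ y) → (∀ {x} → x ∈ xs → f x ∈ ys) →
  length xs ≤ length ys
injectiveOn⇒length≤ _≟_ {xs} {ys} f uniq injective into = begin
  length xs                                ≡⟨ ∑-1 xs ⟨
  ∑ xs (λ _ → 1)                           ≤⟨ ∑-mono xs (λ x∈xs → 1≤∑𝟙 (_ ≟_) (into x∈xs) refl) ⟩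
  ∑ xs (λ x → ∑ ys (λ y → 𝟙 (f x ≟ y)))    ≡⟨ ∑-swap xs ys _ ⟩
  ∑ ys (λ y → ∑ xs (λ x → 𝟙 (f x ≟ y)))    ≤⟨ ∑-mono ys (λ _ → ∑𝟙≤1 (λ x → f x ≟ _) uniq λ x∈ y∈ fx≡ fy≡ →
                                                injective x∈ y∈ (trans fx≡ (sym fy≡))) ⟩
  ∑ ys (λ _ → 1)                           ≡⟨ ∑-1 ys ⟩
  length ys                                ∎
  where open ≤-Reasoning

-- This is `(n - t)² ≥ 0`; naming the difference `d` in either order avoids truncated subtraction.
2tn≤n²+t² : ∀ t n → 2 * t * n ≤ n * n + t * t
2tn≤n²+t² t n with ≤-total t n
... | inj₁ t≤n with d , refl ← m≤n⇒∃[o]m+o≡n t≤n = ≤-trans (m≤m+n _ (d * d)) (≤-reflexive (lemma t d))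
  where
  lemma : ∀ t d → 2 * t * (t + d) + d * d ≡ (t + d) * (t + d) + t * t
  lemma = solve-∀
... | inj₂ n≤t with d , refl ← m≤n⇒∃[o]m+o≡n n≤t = ≤-trans (m≤m+n _ (d * d)) (≤-reflexive (lemma n d))
  where
  lemma : ∀ n d → 2 * (n + d) * n + d * d ≡ n * n + (n + d) * (n + d)
  lemma = solve-∀

-- Cauchy–Schwarz for the class sizes n c, linearised as n² ≥ 2tn - t².
∑-class-size : ∀ {m} (π : X → Fin m) (A : List X) t → t * m ≤ length A →
               t * length A ≤ ∑ A (λ x → ∑ A (λ y → 𝟙 (π y Fin.≟ π x)))
∑-class-size {m = m} π A t tm≤A = +-cancelʳ-≤ (t * length A) _ _ (begin
  t * length A + t * length A        ≡⟨ double t (length A) ⟩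
  2 * t * length A                   ≤⟨ *-monoʳ-≤ (2 * t) A≤∑n ⟩
  2 * t * ∑ cs n                     ≡⟨ ∑-*ˡ cs (2 * t) n ⟨
  ∑ cs (λ c → 2 * t * n c)           ≤⟨ ∑-mono cs (λ {c} _ → 2tn≤n²+t² t (n c)) ⟩
  ∑ cs (λ c → n c * n c + t * t)     ≡⟨ ∑-+ cs _ _ ⟩
  ∑ cs (λ c → n c * n c) + ∑ cs (λ _ → t * t)
    ≤⟨ +-mono-≤ ∑n²≤ (≤-reflexive (trans (∑-const cs (t * t)) (cong (_* (t * t)) (length-tabulate {n = m} (λ i → i))))) ⟩
  ∑ A (λ x → n (π x)) + m * (t * t)  ≡⟨ cong (∑ A (λ x → n (π x)) +_) (rearrange m t) ⟩
  -- The total error `m t²` of the linearisation costs at most half of `2 t |A|`.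
  ∑ A (λ x → n (π x)) + t * (t * m)  ≤⟨ +-monoʳ-≤ (∑ A λ x → n (π x)) (*-monoʳ-≤ t tm≤A) ⟩
  ∑ A (λ x → n (π x)) + t * length A ∎)
  where
  open ≤-Reasoning
  double : ∀ t a → t * a + t * a ≡ 2 * t * a
  double = solve-∀
  rearrange : ∀ m t → m * (t * t) ≡ t * (t * m)
  rearrange = solve-∀
  cs = allFin m
  n : Fin m → ℕ
  n c = ∑ A (λ y → 𝟙 (π y Fin.≟ c))
  A≤∑n : length A ≤ ∑ cs n
  A≤∑n = begin
    length A                                     ≡⟨ ∑-1 A ⟨
    ∑ A (λ _ → 1)                                ≤⟨ ∑-mono A (λ {x} _ → 1≤∑𝟙 (π x Fin.≟_) (∈-allFin (π x)) refl) ⟩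
    ∑ A (λ y → ∑ cs (λ c → 𝟙 (π y Fin.≟ c)))     ≡⟨ ∑-swap A cs _ ⟩
    ∑ cs n                                       ∎
  n-at : ∀ x c → 𝟙 (π x Fin.≟ c) * n c ≤ 𝟙 (π x Fin.≟ c) * n (π x)
  n-at x c with π x Fin.≟ c
  ... | yes refl = ≤-refl
  ... | no _     = z≤n
  -- One factor `n c` is expanded as a count over `x`; after the swap, each `x` contributes the size
  -- of its own class.
  ∑n²≤ : ∑ cs (λ c → n c * n c) ≤ ∑ A (λ x → n (π x))
  ∑n²≤ = begin
    ∑ cs (λ c → n c * n c)                               ≤⟨ ∑-mono cs (λ {c} _ → ≤-reflexive (sym (∑-*ʳ A _ (n c)))) ⟩
    ∑ cs (λ c → ∑ A (λ x → 𝟙 (π x Fin.≟ c) * n c))       ≡⟨ ∑-swap cs A _ ⟩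
    ∑ A (λ x → ∑ cs (λ c → 𝟙 (π x Fin.≟ c) * n c))       ≤⟨ ∑-mono A (λ {x} _ → ∑-mono cs λ {c} _ → n-at x c) ⟩
    ∑ A (λ x → ∑ cs (λ c → 𝟙 (π x Fin.≟ c) * n (π x)))   ≤⟨ ∑-mono A (λ {x} _ → ≤-reflexive (∑-*ʳ cs _ (n (π x)))) ⟩
    ∑ A (λ x → ∑ cs (λ c → 𝟙 (π x Fin.≟ c)) * n (π x))   ≤⟨ ∑-mono A (λ {x} _ → *-monoˡ-≤ (n (π x)) (∑𝟙≤1 (π x Fin.≟_) (allFin⁺ m) λ { _ _ refl refl → refl })) ⟩
    ∑ A (λ x → 1 * n (π x))                              ≤⟨ ∑-mono A (λ {x} _ → ≤-reflexive (*-identityˡ (n (π x)))) ⟩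
    ∑ A (λ x → n (π x))                                  ∎

-- Enumerating short lists.

length-cartesianProductWith : ∀ (f : X → Y → Z) xs ys →
  length (cartesianProductWith f xs ys) ≡ length xs * length ys
length-cartesianProductWith f []       ys = refl
length-cartesianProductWith f (x ∷ xs) ys = trans (length-++ (map (f x) ys))
  (cong₂ _+_ (length-map (f x) ys) (length-cartesianProductWith f xs ys))

length-concatMap-≤ : ∀ (f : X → List Y) {c} → (∀ x → length (f x) ≤ c) → ∀ xs →
  length (concatMap f xs) ≤ length xs * c
length-concatMap-≤ f f≤c []       = z≤n
length-concatMap-≤ f f≤c (x ∷ xs) = ≤-trans (≤-reflexive (length-++ (f x)))
  (+-mono-≤ (f≤c x) (length-concatMap-≤ f f≤c xs))

listsUpTo : ℕ → List X → List (List X)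
listsUpTo zero    xs = [ [] ]
listsUpTo (suc k) xs = [] ∷ cartesianProductWith _∷_ xs (listsUpTo k xs)

∈-listsUpTo : ∀ {k} {xs ys : List X} → length ys ≤ k → (∀ {y} → y ∈ ys → y ∈ xs) → ys ∈ listsUpTo k xs
∈-listsUpTo {k = zero}  {ys = []}     _         _     = here refl
∈-listsUpTo {k = suc k} {ys = []}     _         _     = here refl
∈-listsUpTo {k = suc k} {ys = y ∷ ys} (s≤s len) ys⊆xs =
  there (∈-cartesianProductWith⁺ _∷_ (ys⊆xs (here refl)) (∈-listsUpTo len (ys⊆xs ∘ there)))

-- At each of `k` positions one either stops or picks an entry of `xs`.
length-listsUpTo : ∀ k (xs : List X) → length (listsUpTo k xs) ≤ (1 + length xs) ^ k
length-listsUpTo zero    xs = ≤-refl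
length-listsUpTo (suc k) xs = begin
  1 + length (cartesianProductWith _∷_ xs (listsUpTo k xs))  ≡⟨ cong suc (length-cartesianProductWith _∷_ xs _) ⟩
  1 + length xs * length (listsUpTo k xs)                    ≤⟨ +-mono-≤ (m^n>0 (1 + length xs) k) (*-monoʳ-≤ (length xs) (length-listsUpTo k xs)) ⟩
  (1 + length xs) ^ suc k                                    ∎
  where open ≤-Reasoning

-- Least witnesses and geometric decay in integers.

least : {P : ℕ → Set} → (∀ n → Dec (P n)) → ∀ n → P n → ∃[ m ] (P m × ∀ j → P j → m ≤ j)
least P? zero    p = zero , p , λ _ _ → z≤n
least P? (suc n) p with P? zero
... | yes p₀ = zero , p₀ , λ _ _ → z≤n
... | no ¬p₀ with m , pm , m≤ ← least (P? ∘ suc) n p =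
  suc m , pm , λ { zero p₀ → contradiction p₀ ¬p₀ ; (suc j) pj → s≤s (m≤ j pj) }

-- Bernoulli's inequality `1 + n/b ≤ (1 + 1/b)^n` with denominators cleared.
bernoulli : ∀ b n → b ^ n * (b + n) ≤ b * (1 + b) ^ n
bernoulli b zero    = ≤-reflexive (trans (*-identityˡ _) (trans (+-identityʳ b) (sym (*-identityʳ b))))
bernoulli b (suc n) = begin
  b * b ^ n * (b + suc n)                        ≡⟨ split b (b ^ n) n ⟩
  b * (b ^ n * (b + n)) + b ^ n * b              ≤⟨ +-monoʳ-≤ (b * (b ^ n * (b + n))) (*-monoʳ-≤ (b ^ n) (m≤m+n b n)) ⟩
  b * (b ^ n * (b + n)) + b ^ n * (b + n)        ≤⟨ +-mono-≤ (*-monoʳ-≤ b (bernoulli b n)) (bernoulli b n) ⟩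
  b * (b * (1 + b) ^ n) + b * (1 + b) ^ n        ≡⟨ merge b ((1 + b) ^ n) ⟩
  b * ((1 + b) * (1 + b) ^ n)                    ∎
  where
  open ≤-Reasoning
  split : ∀ b x n → b * x * (b + suc n) ≡ b * (x * (b + n)) + x * b
  split = solve-∀
  merge : ∀ b x → b * (b * x) + b * x ≡ b * ((1 + b) * x)
  merge = solve-∀

2*b^b≤[1+b]^b : ∀ b .{{_ : NonZero b}} → 2 * b ^ b ≤ (1 + b) ^ b
2*b^b≤[1+b]^b b = *-cancelˡ-≤ b (≤-trans (≤-reflexive (lemma b (b ^ b))) (bernoulli b b))
  where
  lemma : ∀ b x → b * (2 * x) ≡ x * (b + b)
  lemma = solve-∀

-- The `l`-th power of `2 ≤ (1 + 1/b)^b`: hence `b * l` shrinkings by the factor `b / (1 + b)`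
-- divide a size by at least `2^l`.
2^l*b^[b*l]≤[1+b]^[b*l] : ∀ b .{{_ : NonZero b}} l → 2 ^ l * b ^ (b * l) ≤ (1 + b) ^ (b * l)
2^l*b^[b*l]≤[1+b]^[b*l] b zero    rewrite *-zeroʳ b = ≤-refl
2^l*b^[b*l]≤[1+b]^[b*l] b (suc l) rewrite *-suc b l = begin
  2 * 2 ^ l * b ^ (b + b * l)            ≡⟨ cong (2 * 2 ^ l *_) (^-distribˡ-+-* b b (b * l)) ⟩
  2 * 2 ^ l * (b ^ b * b ^ (b * l))      ≡⟨ lemma (2 ^ l) (b ^ b) (b ^ (b * l)) ⟩
  2 * b ^ b * (2 ^ l * b ^ (b * l))      ≤⟨ *-mono-≤ (2*b^b≤[1+b]^b b) (2^l*b^[b*l]≤[1+b]^[b*l] b l) ⟩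
  (1 + b) ^ b * (1 + b) ^ (b * l)        ≡⟨ ^-distribˡ-+-* (1 + b) b (b * l) ⟨
  (1 + b) ^ (b + b * l)                  ∎
  where
  open ≤-Reasoning
  lemma : ∀ x y z → 2 * x * (y * z) ≡ 2 * y * (x * z)
  lemma = solve-∀

-- The invariant bounds `n` by `M` times `((1 + b) / b)` to the number of shrinkings left; a
-- shrinking pays for lowering that number by one.
decay-step : ∀ b r {n n′ M} → n′ * (1 + b) ≤ n * b → n * b ^ suc r ≤ (1 + b) ^ suc r * M →
             n′ * b ^ r ≤ (1 + b) ^ r * M
decay-step b r {n} {n′} {M} shrink inv = *-cancelˡ-≤ (1 + b) (begin
  (1 + b) * (n′ * b ^ r)      ≡⟨ lemma b n′ (b ^ r) ⟩
  n′ * (1 + b) * b ^ r        ≤⟨ *-monoˡ-≤ (b ^ r) shrink ⟩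
  n * b * b ^ r               ≡⟨ *-assoc n b (b ^ r) ⟩
  n * (b * b ^ r)             ≤⟨ inv ⟩
  (1 + b) * (1 + b) ^ r * M   ≡⟨ *-assoc (1 + b) ((1 + b) ^ r) M ⟩
  (1 + b) * ((1 + b) ^ r * M) ∎)
  where
  open ≤-Reasoning
  lemma : ∀ b n x → (1 + b) * (n * x) ≡ n * (1 + b) * x
  lemma = solve-∀

-- With `t = n / suc q`, at least `k(t - 1)` points go. From `t ≥ 4` and `q + 1 ≤ 2k²` follows
-- `n ≤ (t + 1)(q + 1) ≤ 2(t - 1) · 2k²`, so the loss is at least `n / 4k`. In the proof `u` stands
-- for `t - 4`.
shrink : ∀ {q k n n′} → q ≤ k * k → 1 ≤ k → 4 * suc q < n → n′ + k * (n / suc q) ≤ n + k →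
         n′ * (1 + 4 * k) ≤ n * (4 * k)
shrink {q} {k} {n} {n′} q≤k² 1≤k 4q<n removed = let u , 4+u≡t = m≤n⇒∃[o]m+o≡n 4≤t in go u 4+u≡t
  where
  open ≤-Reasoning
  n≤ : n ≤ (1 + n / suc q) * suc q
  n≤ = ≤-trans (≤-reflexive (m≡m%n+[m/n]*n n (suc q))) (+-monoˡ-≤ _ (<⇒≤ (m%n<n n (suc q))))
  4≤t : 4 ≤ n / suc q
  4≤t = s≤s⁻¹ (*-cancelʳ-< (suc q) 4 (1 + n / suc q) (<-≤-trans 4q<n n≤))
  expand : ∀ n k → n * (1 + 4 * k) ≡ n + 4 * k * n
  expand = solve-∀
  collect : ∀ u k n → 2 * (3 + u) * (k * k + k * k) + 4 * k * n ≡ (n + k * (3 + u)) * (4 * k)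
  collect = solve-∀
  5+u≤ : ∀ u → 5 + u ≤ 2 * (3 + u)
  5+u≤ u = ≤-trans (m≤m+n (5 + u) (1 + u)) (≤-reflexive (lemma u))
    where
    lemma : ∀ u → 5 + u + (1 + u) ≡ 2 * (3 + u)
    lemma = solve-∀
  n′+≤n : ∀ u → 4 + u ≡ n / suc q → n′ + k * (3 + u) ≤ n
  n′+≤n u 4+u≡t = +-cancelʳ-≤ k _ _ (≤-trans (≤-reflexive
    (trans (lemma n′ k u) (cong (λ t → n′ + k * t) 4+u≡t))) removed)
    where
    lemma : ∀ n k u → n + k * (3 + u) + k ≡ n + k * (4 + u)
    lemma = solve-∀
  go : ∀ u → 4 + u ≡ n / suc q → n′ * (1 + 4 * k) ≤ n * (4 * k)
  go u 4+u≡t = begin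
    n′ * (1 + 4 * k)                             ≡⟨ expand n′ k ⟩
    n′ + 4 * k * n′                              ≤⟨ +-monoˡ-≤ (4 * k * n′) (≤-trans (m≤m+n n′ _) (n′+≤n u 4+u≡t)) ⟩
    n + 4 * k * n′                               ≤⟨ +-monoˡ-≤ (4 * k * n′) n≤ ⟩
    (1 + n / suc q) * suc q + 4 * k * n′         ≡⟨ cong (λ t → (1 + t) * suc q + 4 * k * n′) 4+u≡t ⟨
    (5 + u) * suc q + 4 * k * n′                 ≤⟨ +-monoˡ-≤ (4 * k * n′) (*-mono-≤ (5+u≤ u) (+-mono-≤ (*-mono-≤ 1≤k 1≤k) q≤k²)) ⟩
    2 * (3 + u) * (k * k + k * k) + 4 * k * n′   ≡⟨ collect u k n′ ⟩
    (n′ + k * (3 + u)) * (4 * k)                 ≤⟨ *-monoˡ-≤ (4 * k) (n′+≤n u 4+u≡t) ⟩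
    n * (4 * k)                                  ∎

-- The container recursion and the number of its leaves.

module Containers {q : ℕ} (F : FiniteField q) where
  open Plane F using (_≟_; slope; module InGeneralPosition)

  open import Data.List.Membership.DecPropositional _≟_ using (_∈?_)

  Points : Set
  Points = List (Point F)

  -- For `x` and `y` other than `v`, equal slopes mean that `y` is on the line joining `v` and `x`;
  -- `cover` therefore keeps `A` disjoint from `V`.
  OffLines : Points → Point F → Point F → Set
  OffLines V x y = All (λ v → slope v y ≢ slope v x) V

  offLines? : ∀ V x → Decidable (OffLines V x)
  offLines? V x y = All.all? (λ v → ¬? (slope v y Fin.≟ slope v x)) V

  degree : Points → Points → Point F → ℕ
  degree V A x = ∑ V (λ v → ∑ A (λ y → 𝟙 (slope v y Fin.≟ slope v x)))

  -- `∑-class-size`, applied to the directions from each `v`, bounds the sum of all degrees by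
  -- `length V * t * length A` from below, so some `x` reaches the average.
  degree-average : ∀ V A t → t * suc q ≤ length A → 1 ≤ length A → Any (λ x → length V * t ≤ degree V A x) A
  degree-average V A t t≤ A≢[] with any? (λ x → length V * t ≤? degree V A x) A
  ... | yes found = found
  ... | no ¬found = contradiction A≢[] (<⇒≱ (s≤s (+-cancelʳ-≤ (length A * kt) (length A) 0 (begin
    length A + length A * kt             ≡⟨ cong₂ _+_ (sym (∑-1 A)) (rearrange (length A) k t) ⟩
    ∑ A (λ _ → 1) + k * (t * length A)   ≤⟨ +-monoʳ-≤ (∑ A (λ _ → 1)) ∑degree≥ ⟩
    ∑ A (λ _ → 1) + ∑ A (degree V A)     ≡⟨ ∑-+ A _ _ ⟨
    ∑ A (λ x → 1 + degree V A x)         ≤⟨ ∑-mono A (λ x∈A → ≰⇒> (¬found ∘ lose x∈A)) ⟩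
    ∑ A (λ _ → kt)                       ≡⟨ ∑-const A kt ⟩
    length A * kt                        ∎))))
    where
    open ≤-Reasoning
    k = length V
    kt = k * t
    rearrange : ∀ a k t → a * (k * t) ≡ k * (t * a)
    rearrange = solve-∀
    ∑degree≥ : k * (t * length A) ≤ ∑ A (degree V A)
    ∑degree≥ = begin
      k * (t * length A)          ≡⟨ ∑-const V _ ⟨
      ∑ V (λ _ → t * length A)    ≤⟨ ∑-mono V (λ {v} _ → ∑-class-size (slope v) A t t≤) ⟩
      ∑ V (λ v → ∑ A (λ x → ∑ A (λ y → 𝟙 (slope v y Fin.≟ slope v x))))   ≡⟨ ∑-swap A V _ ⟨
      ∑ A (degree V A)            ∎

  -- The choice depends on `V` and `A` but not on `S`, so all runs can be listed without knowing
  -- `S`.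
  candidate : Points → Points → Maybe (Point F)
  candidate V A with length A ≤? 4 * suc q
  ... | yes _ = nothing
  ... | no _ with any? (λ x → length V * (length A / suc q) ≤? degree V A x) A
  ...   | yes found = just (proj₁ (find found))
  -- An unreachable default, by `degree-average`.
  ...   | no _      = nothing

  candidate-nothing : ∀ V A → candidate V A ≡ nothing → length A ≤ 4 * suc q
  candidate-nothing V A eq with length A ≤? 4 * suc q
  ... | yes small = small
  ... | no large with any? (λ x → length V * (length A / suc q) ≤? degree V A x) A
  ...   | no ¬found = contradiction
    (degree-average V A (length A / suc q) (m/n*n≤m (length A) (suc q)) (≤-<-trans z≤n (≰⇒> large))) ¬found
  candidate-nothing V A () | no large | yes _

  candidate-just : ∀ V A {x} → candidate V A ≡ just x →
    x ∈ A × 4 * suc q < length A × length V * (length A / suc q) ≤ degree V A x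
  candidate-just V A eq with length A ≤? 4 * suc q
  candidate-just V A () | yes _
  ... | no large with any? (λ x → length V * (length A / suc q) ≤? degree V A x) A
  candidate-just V A refl | no large | yes found with x , x∈A , high ← find found = x∈A , ≰⇒> large , high
  candidate-just V A () | no large | no _

  -- The pairs of lists acc, A keep S ⊆ acc ∪ A, with acc ⊆ S on the branch that follows S. If the
  -- candidate x lies in S, then S meets the lines joining x to V only in x and V.
  containers : Points → ℕ → ℕ → Points → Points → List Points
  containers V zero    r       A acc = [ acc ++ A ]
  containers V (suc n) zero    A acc = [ acc ++ A ]
  containers V (suc n) (suc r) A acc with candidate V A
  ... | nothing = [ acc ++ A ]
  ... | just x  = containers V n (suc r) (filter (λ y → ¬? (y ≟ x)) A) acc
               ++ containers V n r (filter (offLines? V x) A) (x ∷ acc)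

  -- A leaf is determined by which of at most `n` steps take the candidate, and at most `r` do. The
  -- induction uses `(1 + n)^(r + 1) + (1 + n)^r ≤ (2 + n)^(r + 1)`.
  length-containers : ∀ V n r A acc → length (containers V n r A acc) ≤ (1 + n) ^ r
  length-containers V zero    r       A acc = m^n>0 1 r
  length-containers V (suc n) zero    A acc = ≤-refl
  length-containers V (suc n) (suc r) A acc with candidate V A
  ... | nothing = m^n>0 (2 + n) (suc r)
  ... | just x  = begin
    length (dropped ++ chosen)             ≡⟨ length-++ dropped ⟩
    length dropped + length chosen         ≤⟨ +-mono-≤ (length-containers V n (suc r) _ _) (length-containers V n r _ _) ⟩
    (1 + n) ^ suc r + (1 + n) ^ r          ≡⟨ +-comm ((1 + n) ^ suc r) _ ⟩
    (2 + n) * (1 + n) ^ r                  ≤⟨ *-monoʳ-≤ (2 + n) (^-monoˡ-≤ r (n≤1+n (1 + n))) ⟩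
    (2 + n) ^ suc r                        ∎
    where
    open ≤-Reasoning
    dropped = containers V n (suc r) (filter (λ y → ¬? (y ≟ x)) A) acc
    chosen  = containers V n r (filter (offLines? V x) A) (x ∷ acc)

  -- The second half leads to `|C| ≤ |S| + |A|`, so the length of `acc` need not be tracked.
  Covering : PointSet F → Points → Set
  Covering S C = (∀ {p} → T (S p) → p ∈ C) × ∃[ A ] (length A ≤ 4 * suc q × ∀ {p} → p ∈ C → T (S p) ⊎ p ∈ A)

  -- Following a general position set through the recursion.

  module Cover (S : PointSet F) (gp : GeneralPosition F S)
               (V : Points) (V-unique : Unique V) (V⊆S : ∀ {v} → v ∈ V → T (S v))
               (1≤k : 1 ≤ length V) (q≤k² : q ≤ length V * length V) where
    open InGeneralPosition {S} gp

    private
      k = length V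
      b = 4 * k

    -- By `pencil-disjoint`, a point other than `x` is off all the lines or on just one, so it
    -- counts at most once on the left. Only `x` is on all `k` of them, hence the extra `k`.
    removal : ∀ {A x} → Unique A → T (S x) → x ∉ V →
              length (filter (offLines? V x) A) + degree V A x ≤ length A + k
    removal {A} {x} A-unique x∈S x∉V = begin
      length (filter (offLines? V x) A) + degree V A x
        ≡⟨ cong₂ _+_ (length-filter-∑ (offLines? V x) A) (∑-swap V A _) ⟩
      ∑ A (λ y → 𝟙 (offLines? V x y)) + ∑ A (λ y → hits y)   ≡⟨ ∑-+ A _ _ ⟨
      ∑ A (λ y → 𝟙 (offLines? V x y) + hits y)               ≤⟨ ∑-mono A (λ {y} _ → pointwise y) ⟩
      ∑ A (λ y → 1 + 𝟙 (y ≟ x) * k)                          ≡⟨ ∑-+ A _ _ ⟩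
      ∑ A (λ _ → 1) + ∑ A (λ y → 𝟙 (y ≟ x) * k)              ≡⟨ cong₂ _+_ (∑-1 A) (∑-*ʳ A _ k) ⟩
      length A + ∑ A (λ y → 𝟙 (y ≟ x)) * k
        ≤⟨ +-monoʳ-≤ (length A) (*-monoˡ-≤ k (∑𝟙≤1 (_≟ x) A-unique λ { _ _ refl refl → refl })) ⟩
      length A + 1 * k                                       ≡⟨ cong (length A +_) (*-identityˡ k) ⟩
      length A + k                                           ∎
      where
      open ≤-Reasoning
      hits : Point F → ℕ
      hits y = ∑ V (λ v → 𝟙 (slope v y Fin.≟ slope v x))
      v≢x : ∀ {v} → v ∈ V → v ≢ x
      v≢x v∈V refl = x∉V v∈V
      pointwise : ∀ y → 𝟙 (offLines? V x y) + hits y ≤ 1 + 𝟙 (y ≟ x) * k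
      pointwise y with y ≟ x
      ... | yes _ = +-mono-≤ (𝟙≤1 (offLines? V x y)) (≤-trans (∑-mono V (λ {v} _ → 𝟙≤1 (slope v y Fin.≟ slope v x)))
                      (≤-reflexive (trans (∑-const V 1) (*-comm k 1))))
      ... | no y≢x with offLines? V x y
      ...   | yes off = ≤-reflexive (cong suc (∑𝟙≡0 (λ v → slope v y Fin.≟ slope v x) V (All.lookup off)))
      ...   | no _    = ∑𝟙≤1 (λ v → slope v y Fin.≟ slope v x) V-unique λ v∈V w∈V →
                          pencil-disjoint x∈S (V⊆S v∈V) (V⊆S w∈V) (v≢x v∈V) (v≢x w∈V) y≢x

    leaf : ∀ {A acc} → length A ≤ 4 * suc q →
           (∀ {p} → T (S p) → p ∈ acc ⊎ p ∈ A) → (∀ {p} → p ∈ acc → T (S p)) → Covering S (acc ++ A)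
    leaf {A} {acc} small S⊆ acc⊆S =
      [ ∈-++⁺ˡ , ∈-++⁺ʳ acc ]′ ∘ S⊆ , A , small , [ inj₁ ∘ acc⊆S , inj₂ ]′ ∘ ∈-++⁻ acc

    -- The inequality says that r shrinkings by the factor b / (1 + b) bring A down to 4(q + 1) points.
    cover : ∀ n r {A acc} → length A ≤ n → Unique A → (∀ {v} → v ∈ V → v ∉ A) →
            length A * b ^ r ≤ (1 + b) ^ r * (4 * suc q) →
            (∀ {p} → T (S p) → p ∈ acc ⊎ p ∈ A) → (∀ {p} → p ∈ acc → T (S p)) →
            ∃[ C ] (C ∈ containers V n r A acc × Covering S C)
    cover zero    r    A≤n _ _ _ S⊆ acc⊆S = _ , here refl , leaf (≤-trans A≤n z≤n) S⊆ acc⊆S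
    -- With no shrinkings left, the inequality itself says that `A` is small.
    cover (suc n) zero A≤n _ _ decay S⊆ acc⊆S = _ , here refl ,
      leaf (≤-trans (≤-reflexive (sym (*-identityʳ _))) (≤-trans decay (≤-reflexive (*-identityˡ _)))) S⊆ acc⊆S
    cover (suc n) (suc r) {A} {acc} A≤n A-unique V∩A decay S⊆ acc⊆S with candidate V A in eq
    ... | nothing = _ , here refl , leaf (candidate-nothing V A eq) S⊆ acc⊆S
    ... | just x with x∈A , large , high ← candidate-just V A eq with T? (S x)
    ...   | no x∉S = let C , C∈ , covering = dropped in C , ∈-++⁺ˡ C∈ , covering
      where
      other? = λ y → ¬? (y ≟ x)
      keep : ∀ {p} → T (S p) → p ∈ acc ⊎ p ∈ A → p ∈ acc ⊎ p ∈ filter other? A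
      keep p∈S (inj₁ p∈acc) = inj₁ p∈acc
      keep p∈S (inj₂ p∈A)   = inj₂ (∈-filter⁺ other? p∈A λ { refl → x∉S p∈S })
      dropped = cover n (suc r)
        (s≤s⁻¹ (<-≤-trans (filter-notAll other? A (lose x∈A λ x≢x → x≢x refl)) A≤n))
        (filter⁺ other? A-unique)
        (λ v∈V → V∩A v∈V ∘ proj₁ ∘ ∈-filter⁻ other?)
        (≤-trans (*-monoˡ-≤ (b ^ suc r) (length-filter other? A)) decay)
        (λ p∈S → keep p∈S (S⊆ p∈S))
        acc⊆S
    ...   | yes x∈S = let C , C∈ , covering = chosen in
        C , ∈-++⁺ʳ (containers V n (suc r) (filter (λ y → ¬? (y ≟ x)) A) acc) C∈ , covering
      where
      x∉V : x ∉ V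
      x∉V x∈V = V∩A x∈V x∈A
      keep : ∀ {p} → T (S p) → p ∈ acc ⊎ p ∈ A → p ∈ x ∷ acc ⊎ p ∈ filter (offLines? V x) A
      keep p∈S (inj₁ p∈acc) = inj₁ (there p∈acc)
      keep {p} p∈S (inj₂ p∈A) with p ≟ x
      ... | yes refl = inj₁ (here refl)
      -- A point of `S` on a deleted line has the direction of `x` from some `v`, hence is `x`.
      ... | no p≢x   = inj₂ (∈-filter⁺ (offLines? V x) p∈A (All.tabulate λ v∈V eq →
        p≢x (slope-injective (V⊆S v∈V) p∈S x∈S (λ { refl → V∩A v∈V p∈A }) (λ { refl → x∉V v∈V }) eq)))
      shrunk : length (filter (offLines? V x) A) * (1 + b) ≤ length A * b
      shrunk = shrink q≤k² 1≤k large (≤-trans (+-monoʳ-≤ (length (filter (offLines? V x) A)) high) (removal A-unique x∈S x∉V))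
      -- Since `V` is nonempty, `x` itself is deleted, so `A` gets strictly shorter and the fuel `n`
      -- suffices.
      hit : ∀ {V} → 1 ≤ length V → ¬ OffLines V x x
      hit {v ∷ V} _ (x≢x ∷ _) = x≢x refl
      chosen = cover n r
        (s≤s⁻¹ (<-≤-trans (filter-notAll (offLines? V x) A (lose x∈A (hit 1≤k))) A≤n))
        (filter⁺ (offLines? V x) A-unique)
        (λ v∈V → V∩A v∈V ∘ proj₁ ∘ ∈-filter⁻ (offLines? V x))
        (decay-step b r {length A} {length (filter (offLines? V x) A)} shrunk decay)
        (λ p∈S → keep p∈S (S⊆ p∈S))
        λ { (here refl) → x∈S ; (there p∈acc) → acc⊆S p∈acc }

  -- The family of all containers.

  points : Points
  points = allPoints F

  ∈-points : ∀ p → p ∈ points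
  ∈-points (x , y) = ∈-cartesianProduct⁺ (∈-allFin x) (∈-allFin y)

  points-unique : Unique points
  points-unique = cartesianProduct⁺ (allFin⁺ q) (allFin⁺ q)

  length-points : length points ≡ q * q
  length-points = trans (length-cartesianProductWith _,_ (allFin q) (allFin q))
    (cong₂ _*_ (length-tabulate {n = q} id) (length-tabulate {n = q} id))

  -- A general position set with at most `k` points is its own container; a larger one supplies its
  -- first `k` points as `V`, and the recursion starts from the rest of the plane.
  family : ℕ → ℕ → List Points
  family k r = listsUpTo k points ++
    concatMap (λ V → containers V (length points) r (filter (λ p → ¬? (p ∈? V)) points) V) (listsUpTo k points)

  length-family : ∀ k r → length (family k r) ≤ (1 + q * q) ^ k * (1 + (1 + q * q) ^ r)
  length-family k r rewrite sym length-points = begin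
    length (family k r)              ≡⟨ length-++ (listsUpTo k points) ⟩
    K + length (concatMap _ (listsUpTo k points))
      ≤⟨ +-monoʳ-≤ K (length-concatMap-≤ _ (λ V → length-containers V (length points) r _ V) (listsUpTo k points)) ⟩
    K + K * (1 + length points) ^ r   ≡⟨ *-suc K _ ⟨
    K * (1 + (1 + length points) ^ r) ≤⟨ *-monoˡ-≤ _ (length-listsUpTo k points) ⟩
    (1 + length points) ^ k * (1 + (1 + length points) ^ r) ∎
    where
    open ≤-Reasoning
    K = length (listsUpTo k points)

  elements : PointSet F → Points
  elements S = filter (T? ∘ S) points

  elements-unique : ∀ S → Unique (elements S)
  elements-unique S = filter⁺ (T? ∘ S) points-unique

  ∈-elements⁺ : ∀ S {p} → T (S p) → p ∈ elements S
  ∈-elements⁺ S = ∈-filter⁺ (T? ∘ S) (∈-points _)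

  ∈-elements⁻ : ∀ S {p} → p ∈ elements S → T (S p)
  ∈-elements⁻ S = proj₂ ∘ ∈-filter⁻ (T? ∘ S) {xs = points}

  -- From one point of `S` the others lie in distinct directions, of which there are `q + 1`.
  general-position-length : ∀ {S} → GeneralPosition F S → length (elements S) ≤ 2 + q
  general-position-length {S} gp = bound (elements S) (elements-unique S) (∈-elements⁻ S)
    where
    open InGeneralPosition {S} gp
    bound : ∀ xs → Unique xs → (∀ {x} → x ∈ xs → T (S x)) → length xs ≤ 2 + q
    bound []       _                 _    = z≤n
    bound (v ∷ xs) (v∉xs ∷ xs-unique) xs⊆S = s≤s (≤-trans
      (injectiveOn⇒length≤ Fin._≟_ (slope v) xs-unique
        (λ x∈ y∈ → slope-injective (xs⊆S (here refl)) (xs⊆S (there x∈)) (xs⊆S (there y∈))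
                     (All.lookup v∉xs x∈) (All.lookup v∉xs y∈))
        (λ _ → ∈-allFin _))
      (≤-reflexive (length-tabulate {n = suc q} id)))

  family-covers : ∀ k r → 1 ≤ k → q ≤ k * k → q * q * (4 * k) ^ r ≤ (1 + 4 * k) ^ r * (4 * suc q) →
                  ∀ S → GeneralPosition F S → ∃[ C ] (C ∈ family k r × Covering S C)
  family-covers k r 1≤k q≤k² decay S gp with ≤-total (length (elements S)) k
  ... | inj₁ S≤k = elements S , ∈-++⁺ˡ (∈-listsUpTo S≤k λ _ → ∈-points _) ,
                   ∈-elements⁺ S , [] , z≤n , inj₁ ∘ ∈-elements⁻ S
  ... | inj₂ k≤S = let C , C∈ , covering = covered in
      C , ∈-++⁺ʳ (listsUpTo k points) (∈-concatMap⁺ _ (lose V∈ C∈)) , covering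
    where
    V = take k (elements S)
    A = filter (λ p → ¬? (p ∈? V)) points
    lengthV : length V ≡ k
    lengthV = trans (length-take k (elements S)) (m≤n⇒m⊓n≡m k≤S)
    V⊆S : ∀ {v} → v ∈ V → T (S v)
    V⊆S = ∈-elements⁻ S ∘ All.lookup (All.take⁺ k (All.tabulate λ p∈ → p∈))
    V∈ : V ∈ listsUpTo k points
    V∈ = ∈-listsUpTo (≤-reflexive lengthV) λ _ → ∈-points _
    split : ∀ p → p ∈ V ⊎ p ∈ A
    split p with p ∈? V
    ... | yes p∈V = inj₁ p∈V
    ... | no p∉V  = inj₂ (∈-filter⁺ (λ p → ¬? (p ∈? V)) (∈-points p) p∉V)
    A≤ : length A ≤ length points
    A≤ = length-filter (λ p → ¬? (p ∈? V)) points
    decayV : length A * (4 * length V) ^ r ≤ (1 + 4 * length V) ^ r * (4 * suc q)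
    decayV = subst (λ k → length A * (4 * k) ^ r ≤ (1 + 4 * k) ^ r * (4 * suc q)) (sym lengthV)
      (≤-trans (*-monoˡ-≤ ((4 * k) ^ r) (≤-trans A≤ (≤-reflexive length-points))) decay)
    open Cover S gp V (take⁺ k (elements-unique S)) V⊆S
      (subst (1 ≤_) (sym lengthV) 1≤k) (subst (λ k → q ≤ k * k) (sym lengthV) q≤k²)
    covered = cover (length points) r A≤ (filter⁺ (λ p → ¬? (p ∈? V)) points-unique)
      (λ v∈V v∈A → proj₂ (∈-filter⁻ (λ p → ¬? (p ∈? V)) {xs = points} v∈A) v∈V)
      decayV (λ {p} _ → split p) V⊆S

  toSet : Points → PointSet F
  toSet C p = does (p ∈? C)

  ∈-toSet : ∀ {p C} → p ∈ C → _∈ₛ_ F p (toSet C)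
  ∈-toSet {p} {C} p∈C = subst T (sym (dec-true (p ∈? C) p∈C)) tt

  card-toSet : ∀ {S C} → 2 ≤ q → GeneralPosition F S → Covering S C → card F (toSet C) ≤ 9 * q
  card-toSet {S} {C} 2≤q gp (_ , A , A≤ , C⊆) = begin
    card F (toSet C)                     ≡⟨ length-filter-∑ (_∈? C) points ⟨
    length (filter (_∈? C) points)       ≤⟨ injectiveOn⇒length≤ _≟_ id (filter⁺ (_∈? C) points-unique) (λ _ _ eq → eq) into ⟩
    length (elements S ++ A)             ≡⟨ length-++ (elements S) ⟩
    length (elements S) + length A       ≤⟨ +-mono-≤ (general-position-length gp) A≤ ⟩
    2 + q + 4 * suc q                    ≡⟨ expand q ⟩
    -- The constant `6` is absorbed by `3q`, as `2 ≤ q`.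
    2 + 2 + 2 + 5 * q                    ≤⟨ +-monoˡ-≤ (5 * q) (+-mono-≤ (+-mono-≤ 2≤q 2≤q) 2≤q) ⟩
    q + q + q + 5 * q                    ≤⟨ m≤m+n _ q ⟩
    q + q + q + 5 * q + q                ≡⟨ collect q ⟩
    9 * q                                ∎
    where
    open ≤-Reasoning
    expand : ∀ q → 2 + q + 4 * suc q ≡ 2 + 2 + 2 + 5 * q
    expand = solve-∀
    collect : ∀ q → q + q + q + 5 * q + q ≡ 9 * q
    collect = solve-∀
    into : ∀ {p} → p ∈ filter (_∈? C) points → p ∈ elements S ++ A
    into p∈ = [ ∈-++⁺ˡ ∘ ∈-elements⁺ S , ∈-++⁺ʳ (elements S) ]′ (C⊆ (proj₂ (∈-filter⁻ (_∈? C) {xs = points} p∈)))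

-- Choice of parameters and the final count.

n≤2^n : ∀ n → n ≤ 2 ^ n
n≤2^n zero    = z≤n
n≤2^n (suc n) = ≤-trans (+-mono-≤ (m^n>0 2 n) (n≤2^n n)) (+-monoʳ-≤ (2 ^ n) (m≤m+n (2 ^ n) 0))

-- After `b * l` shrinkings, `q²` points become at most `q² / 2^l ≤ q`.
square-decay : ∀ {q l} b .{{_ : NonZero b}} → q ≤ 2 ^ l → q * q * b ^ (b * l) ≤ (1 + b) ^ (b * l) * (4 * suc q)
square-decay {q} {l} b q≤2^l = begin
  q * q * b ^ (b * l)                    ≡⟨ lemma q (b ^ (b * l)) ⟩
  q * b ^ (b * l) * q                    ≤⟨ *-mono-≤ (*-monoˡ-≤ (b ^ (b * l)) q≤2^l) (≤-trans (n≤1+n q) (m≤n*m (suc q) 4)) ⟩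
  2 ^ l * b ^ (b * l) * (4 * suc q)      ≤⟨ *-monoˡ-≤ (4 * suc q) (2^l*b^[b*l]≤[1+b]^[b*l] b l) ⟩
  (1 + b) ^ (b * l) * (4 * suc q)        ∎
  where
  open ≤-Reasoning
  lemma : ∀ q x → q * q * x ≡ q * x * q
  lemma = solve-∀

-- As `1 + q² ≤ 2^(3L)`, the exponent is at most `3Lk + 1 + 12Lkl`. The three terms are at most `3`,
-- `1` and `12` times `sL²`, whence the `16`.
family-bound : ∀ {q k l s L} → 1 ≤ s → 1 ≤ L → q ≤ 2 ^ L → k ≤ s → l ≤ L →
               (1 + q * q) ^ k * (1 + (1 + q * q) ^ (4 * k * l)) ≤ 2 ^ (16 * s * L * L)
family-bound {q} {k} {l} {s} {L} 1≤s 1≤L q≤2^L k≤s l≤L = begin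
  (1 + q * q) ^ k * (1 + (1 + q * q) ^ r)      ≤⟨ *-mono-≤ (power k) (≤-trans (+-mono-≤ (m^n>0 2 (3 * L * r)) (power r)) (+-monoʳ-≤ (2 ^ (3 * L * r)) (m≤m+n _ 0))) ⟩
  2 ^ (3 * L * k) * 2 ^ (1 + 3 * L * r)        ≡⟨ ^-distribˡ-+-* 2 (3 * L * k) (1 + 3 * L * r) ⟨
  2 ^ (3 * L * k + (1 + 3 * L * r))            ≤⟨ ^-monoʳ-≤ 2 exponent ⟩
  2 ^ (16 * s * L * L)                         ∎
  where
  open ≤-Reasoning
  r = 4 * k * l
  base : 1 + q * q ≤ 2 ^ (3 * L)
  base = begin
    1 + q * q                  ≤⟨ +-mono-≤ (*-mono-≤ (m^n>0 2 L) (m^n>0 2 L)) (*-mono-≤ q≤2^L q≤2^L) ⟩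
    2 ^ L * 2 ^ L + 2 ^ L * 2 ^ L   ≡⟨ double (2 ^ L) ⟩
    2 * (2 ^ L * 2 ^ L)        ≤⟨ *-monoˡ-≤ (2 ^ L * 2 ^ L) (^-monoʳ-≤ 2 1≤L) ⟩
    2 ^ L * (2 ^ L * 2 ^ L)    ≡⟨ cong (2 ^ L *_) (^-distribˡ-+-* 2 L L) ⟨
    2 ^ L * 2 ^ (L + L)        ≡⟨ ^-distribˡ-+-* 2 L (L + L) ⟨
    2 ^ (L + (L + L))          ≡⟨ cong (2 ^_) (triple L) ⟩
    2 ^ (3 * L)                ∎
    where
    double : ∀ x → x * x + x * x ≡ 2 * (x * x)
    double = solve-∀
    triple : ∀ x → x + (x + x) ≡ 3 * x
    triple = solve-∀
  power : ∀ e → (1 + q * q) ^ e ≤ 2 ^ (3 * L * e)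
  power e = ≤-trans (^-monoˡ-≤ e base) (≤-reflexive (^-*-assoc 2 (3 * L) e))
  exponent : 3 * L * k + (1 + 3 * L * r) ≤ 16 * s * L * L
  exponent = begin
    3 * L * k + (1 + 3 * L * (4 * k * l))
      ≤⟨ +-mono-≤ (≤-trans (*-monoʳ-≤ (3 * L) k≤s) (≤-trans (≤-reflexive (sym (*-identityʳ _))) (*-monoʳ-≤ (3 * L * s) 1≤L)))
           (+-mono-≤ (*-mono-≤ (*-mono-≤ 1≤s 1≤L) 1≤L) (*-monoʳ-≤ (3 * L) (*-mono-≤ (*-monoʳ-≤ 4 k≤s) l≤L))) ⟩
    3 * L * s * L + (s * L * L + 3 * L * (4 * s * L))   ≡⟨ collect s L ⟩
    16 * s * L * L                                      ∎
    where
    collect : ∀ s L → 3 * L * s * L + (s * L * L + 3 * L * (4 * s * L)) ≡ 16 * s * L * L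
    collect = solve-∀

-- Real roots and logarithms are avoided by letting `s` and `L` be any integers with `s ≥ √q` and
-- `L ≥ log q`; rounding up both only changes the constant.
theorem3p5 : ∃[ c ] (0 < c × ∃[ q₀ ] (∀ q → q₀ ≤ q → IsPrimePower q → (F : FiniteField q) →
    ∃[ 𝒞 ] ((∀ S → GeneralPosition F S → ∃[ C ] (C ∈ 𝒞 × _⊆ₛ_ F S C))
    × All (λ C → card F C ≤ 9 * q) 𝒞
    × (∀ s L → q ≤ s * s → q ≤ 2 ^ L → length 𝒞 ≤ 2 ^ (c * s * L * L)))))
theorem3p5 = 16 , s≤s z≤n , 2 , λ q 2≤q _ F →
  let open Containers F
      -- `k` and `l` are `√q` and `log q` rounded up; being least, they are below every admissible
      -- `s` and `L`.
      k , q≤k² , k-least = least (λ k → q ≤? k * k) q (m≤m*n q q {{>-nonZero (<⇒≤ 2≤q)}})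
      l , q≤2^l , l-least = least (λ l → q ≤? 2 ^ l) q (n≤2^n q)
      1≤k = positive-root (<⇒≤ 2≤q) q≤k²
      -- The number of choices is `b * l` with `b = 4 * k`, as in `square-decay`.
      sets = map toSet (family k (4 * k * l))
      -- The size bound is known only for containers reached by a general position set; any other
      -- that exceeds it is discarded.
      small? = λ C → card F C ≤? 9 * q
  in filter small? sets
   , (λ S gp →
       let C , C∈ , covering = family-covers k (4 * k * l) 1≤k q≤k²
                                 (square-decay {l = l} (4 * k) {{>-nonZero (≤-trans 1≤k (m≤n*m k 4))}} q≤2^l) S gp
       in toSet C , ∈-filter⁺ small? (∈-map⁺ toSet C∈) (card-toSet {S} {C} 2≤q gp covering)
          , λ p p∈S → ∈-toSet (proj₁ covering p∈S))
   , All.all-filter small? sets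
   , λ s L q≤s² q≤2^L → begin
       length (filter small? sets)          ≤⟨ length-filter small? sets ⟩
       length sets                          ≡⟨ length-map toSet (family k (4 * k * l)) ⟩
       length (family k (4 * k * l))        ≤⟨ length-family k (4 * k * l) ⟩
       (1 + q * q) ^ k * (1 + (1 + q * q) ^ (4 * k * l))
         ≤⟨ family-bound (positive-root (<⇒≤ 2≤q) q≤s²) (positive-log 2≤q q≤2^L) q≤2^L (k-least s q≤s²) (l-least L q≤2^L) ⟩
       2 ^ (16 * s * L * L)                 ∎
  where
  open ≤-Reasoning
  positive-root : ∀ {q k} → 1 ≤ q → q ≤ k * k → 1 ≤ k
  positive-root {k = zero}  1≤q q≤0 = ≤-trans 1≤q q≤0
  positive-root {k = suc _} _   _   = s≤s z≤n
  positive-log : ∀ {q L} → 2 ≤ q → q ≤ 2 ^ L → 1 ≤ L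
  positive-log {L = zero}  2≤q q≤1 = s≤s⁻¹ (≤-trans 2≤q q≤1)
  positive-log {L = suc _} _   _   = s≤s z≤n
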